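{- Let $i \ge 3$ be an integer and let $n = 2i$. Then the automorphism group of the Johnson graph $J(n,i)$ is $S_n \times \langle T \rangle$, where $T$ is the complementation map $A \mapsto A^c = \{1,\ldots,n\}\setminus A$ on the vertices of $J(n,i)$ and $S_n$ is identified with the group $\{\rho_\theta : \theta \in S_n\}$ of permutations of the vertex set induced by $S_n$. That is, $\operatorname{Aut}(J(n,i))$ is the internal direct product of its subgroups $\{\rho_\theta : \theta \in S_n\} \cong S_n$ and $\langle T \rangle$.
   Context: The Johnson graph $J(n,i)$ is the graph whose vertices are the $i$-element subsets of $\{1,\ldots,n\}$, with two vertices $A, B$ adjacent if and only if $|A \cap B| = i-1$. The automorphism group of a graph is the group of all permutations of its vertex set that preserve adjacency and nonadjacency. For $\theta \in S_n$ (the symmetric group on $\{1,\ldots,n\}$), $\rho_\theta$ denotes the permutation $A \mapsto \theta(A) = \{\theta(a) : a \in A\}$ of the vertex set of $J(n,i)$. When $n = 2i$, the complement $A^c$ of an $i$-element subset is again an $i$-element subset, so $T$ is a permutation of the vertex set. -}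

module Defs where

open import Algebra.Bundles using (Group)
import Algebra.Properties.CommutativeMonoid.Sum as MonoidSum
open import Data.Bool.Base using (Bool; true; false; if_then_else_)
open import Data.Bool.Properties using (not-involutive)
open import Data.Fin.Base using (Fin)
open import Data.Fin.Permutation using (Permutation′; _⟨$⟩ʳ_; _⟨$⟩ˡ_; flip; inverseˡ; inverseʳ)
open import Data.Fin.Properties using (any?; _≟_)
open import Data.Fin.Subset using (Subset; ∣_∣; _∈_; _∩_; ∁)
open import Data.Fin.Subset.Properties using (_∈?_; ∩-comm; ∩-idem; ∣∁p∣≡n∸∣p∣)
open import Data.Nat.Base using (ℕ; suc; _+_; _*_; _∸_)
open import Data.Nat.Properties using (≡-irrelevant; 1+n≢n; m+n∸n≡m; +-identityʳ; +-0-commutativeMonoid)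
open import Data.Product.Base using (Σ; ∃-syntax; ∃₂; _×_; _,_; proj₁; proj₂)
open import Data.Vec.Base using (Vec; []; _∷_; lookup; tabulate)
open import Data.Vec.Properties using (lookup∘tabulate; tabulate∘lookup; tabulate-cong; map-id; map-cong; map-∘; []=⇒lookup; lookup⇒[]=)
open import Function.Base using (_∘_)
open import Function.Bundles using (Inverse; _↔_; _⇔_; mk↔ₛ′)
open import Function.Construct.Composition using (_↔-∘_)
open import Function.Construct.Identity using (↔-id)
open import Function.Construct.Symmetry using (↔-sym)
open import Level using (Level; _⊔_)
open import Relation.Binary.Core using (Rel)
open import Relation.Binary.Definitions using (Symmetric; Irreflexive)
open import Relation.Binary.PropositionalEquality using (_≡_; refl; sym; trans; cong; module ≡-Reasoning)
open import Relation.Nullary using (¬_)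
open import Relation.Nullary.Decidable using (does; dec-true; dec-false; _×-dec_)
open import Relation.Unary using (Pred; _⊆_)

private
  variable
    a p q r : Level
    n i : ℕ

-- The product σ ∙ τ applies τ first; equality of permutations is pointwise.

Sym : Set a → Group a a
Sym X = record
  { Carrier = X ↔ X
  ; _≈_     = λ σ τ → ∀ x → Inverse.to σ x ≡ Inverse.to τ x
  ; _∙_     = _↔-∘_
  ; ε       = ↔-id X
  ; _⁻¹     = ↔-sym
  ; isGroup = record
    { isMonoid = record
      { isSemigroup = record
        { isMagma = record
          { isEquivalence = record
            { refl  = λ _ → refl
            ; sym   = λ e x → sym (e x)
            ; trans = λ e f x → trans (e x) (f x)
            }
          ; ∙-cong = λ {σ} {σ′} {τ} {τ′} e f x →
              trans (cong (Inverse.to σ) (f x)) (e (Inverse.to τ′ x))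
          }
        ; assoc = λ _ _ _ _ → refl
        }
      ; identity = (λ _ _ → refl) , (λ _ _ → refl)
      }
    ; inverse = (λ σ _ → Inverse.strictlyInverseʳ σ _) , (λ σ _ → Inverse.strictlyInverseˡ σ _)
    ; ⁻¹-cong = λ {σ} {τ} e x →
        trans (cong (Inverse.from σ) (sym (Inverse.strictlyInverseˡ τ x)))
       (trans (cong (Inverse.from σ) (sym (e (Inverse.from τ x))))
              (Inverse.strictlyInverseʳ σ (Inverse.from τ x)))
    }
  }

module _ {c ℓ} (G : Group c ℓ) where
  open Group G

  record IsSubgroup (H : Pred Carrier p) : Set (c ⊔ ℓ ⊔ p) where
    field
      resp-≈    : ∀ {x y} → x ≈ y → H x → H y
      ε-closed  : H ε
      ∙-closed  : ∀ {x y} → H x → H y → H (x ∙ y)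
      ⁻¹-closed : ∀ {x} → H x → H (x ⁻¹)

  data Generated (t : Carrier) : Pred Carrier (c ⊔ ℓ) where
    gen    : Generated t t
    resp   : ∀ {x y} → x ≈ y → Generated t x → Generated t y
    unit   : Generated t ε
    mult   : ∀ {x y} → Generated t x → Generated t y → Generated t (x ∙ y)
    invert : ∀ {x} → Generated t x → Generated t (x ⁻¹)

  -- The subgroup P of G is the internal direct product of its subgroups H and K.

  record IsInternalDirectProduct (P : Pred Carrier p) (H : Pred Carrier q) (K : Pred Carrier r)
    : Set (c ⊔ ℓ ⊔ p ⊔ q ⊔ r) where
    field
      P-isSubgroup : IsSubgroup P
      H-isSubgroup : IsSubgroup H
      K-isSubgroup : IsSubgroup K
      H⊆P          : H ⊆ P
      K⊆P          : K ⊆ P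
      H-normal     : ∀ {g h} → P g → H h → H (g ∙ h ∙ g ⁻¹)
      K-normal     : ∀ {g k} → P g → K k → K (g ∙ k ∙ g ⁻¹)
      H∩K-trivial  : ∀ {x} → H x → K x → x ≈ ε
      P⊆HK         : ∀ {x} → P x → ∃₂ λ h k → H h × K k × x ≈ h ∙ k

record Graph : Set₁ where
  field
    Vertex : Set
    Adj    : Rel Vertex _
    symm   : Symmetric Adj
    irrefl : Irreflexive _≡_ Adj

-- The right-to-left implication is preservation of nonadjacency, contraposed
-- (equivalent when Adj is decidable).

Aut : (Γ : Graph) → let open Graph Γ in Pred (Vertex ↔ Vertex) _
Aut Γ σ = ∀ A B → Adj A B ⇔ Adj (Inverse.to σ A) (Inverse.to σ B)
  where open Graph Γ

JVertex : ℕ → ℕ → Set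
JVertex n i = Σ (Subset n) λ A → ∣ A ∣ ≡ i

JVertex-≡ : {A B : JVertex n i} → proj₁ A ≡ proj₁ B → A ≡ B
JVertex-≡ {A = _ , p} {B = _ , q} refl = cong (_ ,_) (≡-irrelevant p q)

-- |A ∩ B| = i - 1 is written suc ∣ A ∩ B ∣ ≡ i, which is also right for i = 0.

J : ℕ → ℕ → Graph
J n i = record
  { Vertex = JVertex n i
  ; Adj    = λ A B → suc ∣ proj₁ A ∩ proj₁ B ∣ ≡ i
  ; symm   = λ {A} {B} e → trans (cong (suc ∘ ∣_∣) (∩-comm (proj₁ B) (proj₁ A))) e
  ; irrefl = λ { {A , ∣A∣≡i} refl e →
      1+n≢n (trans (cong (suc ∘ ∣_∣) (sym (∩-idem A))) (trans e (sym ∣A∣≡i))) }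
  }

image : ∀ {m n} → (Fin m → Fin n) → Subset m → Subset n
image f A = tabulate λ y → does (any? λ x → (x ∈? A) ×-dec (f x ≟ y))

open MonoidSum +-0-commutativeMonoid using (sum; sum-permute; sum-cong-≗)

lookup-ext : ∀ {A : Set} {u v : Vec A n} → (∀ j → lookup u j ≡ lookup v j) → u ≡ v
lookup-ext {u = u} {v} e =
  trans (sym (tabulate∘lookup u)) (trans (tabulate-cong e) (tabulate∘lookup v))

lookup-image : (θ : Permutation′ n) (A : Subset n) (y : Fin n) →
               lookup (image (θ ⟨$⟩ʳ_) A) y ≡ lookup A (θ ⟨$⟩ˡ y)
lookup-image θ A y = trans (lookup∘tabulate _ y) (lemma _ refl)
  where
  mem? = any? λ x → (x ∈? A) ×-dec ((θ ⟨$⟩ʳ x) ≟ y)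
  back : ∀ {x} → θ ⟨$⟩ʳ x ≡ y → x ≡ θ ⟨$⟩ˡ y
  back {x} e = trans (sym (inverseˡ θ)) (cong (θ ⟨$⟩ˡ_) e)
  lemma : ∀ b → lookup A (θ ⟨$⟩ˡ y) ≡ b → does mem? ≡ lookup A (θ ⟨$⟩ˡ y)
  lemma true  e = trans (dec-true mem? (_ , lookup⇒[]= _ A e , inverseʳ θ)) (sym e)
  lemma false e = trans (dec-false mem? no) (sym e)
    where
    no : ¬ (∃[ x ] x ∈ A × θ ⟨$⟩ʳ x ≡ y)
    no (x , x∈A , fx≡y) with () ← trans (sym e) (trans (cong (lookup A) (sym (back fx≡y))) ([]=⇒lookup x∈A))

bit : Bool → ℕ
bit b = if b then 1 else 0

∣∣-sum : (A : Subset n) → ∣ A ∣ ≡ sum (bit ∘ lookup A)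
∣∣-sum []          = refl
∣∣-sum (true ∷ A)  = cong suc (∣∣-sum A)
∣∣-sum (false ∷ A) = ∣∣-sum A

∣image∣ : (θ : Permutation′ n) (A : Subset n) → ∣ image (θ ⟨$⟩ʳ_) A ∣ ≡ ∣ A ∣
∣image∣ θ A = begin
  ∣ image (θ ⟨$⟩ʳ_) A ∣                        ≡⟨ ∣∣-sum (image (θ ⟨$⟩ʳ_) A) ⟩
  sum (bit ∘ lookup (image (θ ⟨$⟩ʳ_) A))       ≡⟨ sum-cong-≗ (cong bit ∘ lookup-image θ A) ⟩
  sum (λ y → bit (lookup A (θ ⟨$⟩ˡ y)))        ≡⟨ sum-permute (bit ∘ lookup A) (flip θ) ⟨
  sum (bit ∘ lookup A)                         ≡⟨ ∣∣-sum A ⟨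
  ∣ A ∣                                        ∎
  where open ≡-Reasoning

image-inverse : (θ : Permutation′ n) (A : Subset n) →
                image (θ ⟨$⟩ʳ_) (image (θ ⟨$⟩ˡ_) A) ≡ A
image-inverse θ A = lookup-ext λ y →
  trans (lookup-image θ _ y)
 (trans (lookup-image (flip θ) A (θ ⟨$⟩ˡ y))
        (cong (lookup A) (inverseʳ θ)))

∁-involutive : (A : Subset n) → ∁ (∁ A) ≡ A
∁-involutive A = trans (sym (map-∘ _ _ A)) (trans (map-cong not-involutive A) (map-id A))

2*i∸i≡i : ∀ i → 2 * i ∸ i ≡ i
2*i∸i≡i i = trans (cong (λ k → i + k ∸ i) (+-identityʳ i)) (m+n∸n≡m i i)

ρ : ∀ n i → Permutation′ n → JVertex n i ↔ JVertex n i
ρ n i θ = mk↔ₛ′ (act θ) (act (flip θ))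
  (λ A → JVertex-≡ (image-inverse θ (proj₁ A)))
  (λ A → JVertex-≡ (image-inverse (flip θ) (proj₁ A)))
  where
  act : Permutation′ n → JVertex n i → JVertex n i
  act θ (A , ∣A∣≡i) = image (θ ⟨$⟩ʳ_) A , trans (∣image∣ θ A) ∣A∣≡i

ρ-Image : ∀ n i → Pred (JVertex n i ↔ JVertex n i) _
ρ-Image n i σ = ∃[ θ ] (σ ≈ ρ n i θ)
  where open Group (Sym (JVertex n i)) using (_≈_)

T : ∀ i → JVertex (2 * i) i ↔ JVertex (2 * i) i
T i = mk↔ₛ′ compl compl (λ A → JVertex-≡ (∁-involutive (proj₁ A))) (λ A → JVertex-≡ (∁-involutive (proj₁ A)))
  where
  compl : JVertex (2 * i) i → JVertex (2 * i) i
  compl (A , ∣A∣≡i) =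
    ∁ A , trans (∣∁p∣≡n∸∣p∣ A) (trans (cong (2 * i ∸_) ∣A∣≡i) (2*i∸i≡i i))

-- Automorphisms preserve |A ∩ B|, since i − |A ∩ B| is the graph distance. Identify a
-- vertex with its indicator vector: preserving |A ∩ B| means preserving inner products,
-- and differences of adjacent vertices are exactly the roots e_a − e_b of type A. An
-- automorphism therefore permutes these roots, and the images of the roots e₀ − e_b
-- (b ≠ 0) either all have the same positive end or all have the same negative end.
-- In the first case the other ends define a permutation θ with σ = ρ_θ; in the second
-- case the first one applies to σ ∘ T, because T acts on the roots as −1. Finally T is
-- central, as A^c is the only vertex disjoint from A.

module Submission where

open import Defs
open import Algebra.Bundles using (Group)
open import Algebra.Morphism.Structures using (module GroupMorphisms)
import Algebra.Properties.Group as GroupProperties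
import Relation.Binary.Reasoning.Setoid as SetoidReasoning
open import Data.Bool.Base using (Bool; true; false; not; _∧_)
open import Data.Fin.Base using (Fin; zero; suc; punchOut)
open import Data.Fin.Permutation using (Permutation′; permutation; _⟨$⟩ʳ_; _⟨$⟩ˡ_; flip; inverseʳ)
open import Data.Fin.Properties as Fin using (any?; _≟_; punchOut-injective; injective⇒≤)
open import Data.Fin.Subset using (Subset; ∣_∣; _∈_; _∉_; _⊆_; _∩_; _∪_; ∁; ⊤; ⊥; ⁅_⁆)
open import Data.Fin.Subset.Properties
open import Data.Nat.Base using (ℕ; zero; suc; _+_; _*_; _∸_; _≤_; _<_; z≤n; s≤s; s≤s⁻¹)
open import Data.Nat.Properties hiding (_≟_)
open import Data.Nat.Tactic.RingSolver using (solve-∀)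
open import Data.Product.Base using (∃₂; ∃-syntax; _×_; _,_; proj₁; proj₂)
open import Data.Sum.Base using (_⊎_; inj₁; inj₂; [_,_]′)
open import Data.Vec.Base using ([]; _∷_; lookup; _[_]≔_; here; there)
open import Data.Vec.Properties using (lookup-map; lookup-zipWith; lookup∘update; lookup∘update′; []≔-idempotent; []≔-lookup; []=⇒lookup; lookup⇒[]=)
open import Function.Base using (_∘_)
open import Function.Bundles using (Inverse; Equivalence; _↔_; _⇔_; mk⇔)
open import Function.Construct.Composition using (_⇔-∘_)
open import Function.Construct.Symmetry using (⇔-sym)
open import Function.Definitions using (Injective)
open import Relation.Binary.PropositionalEquality using (_≡_; _≢_; refl; sym; trans; cong; cong₂; subst; subst₂; module ≡-Reasoning)
open import Relation.Nullary using (¬_; yes; no; contradiction)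
open import Relation.Nullary.Decidable using (decidable-stable)
open import Relation.Unary using (Pred) renaming (_⊆_ to _⊑_)

open import Algebra.Properties.CommutativeSemigroup +-commutativeSemigroup using (xy∙z≈xz∙y)

private
  variable
    n : ℕ

-- Indicators and cardinalities of finite subsets.

χ : Subset n → Fin n → ℕ
χ A a = bit (lookup A a)

bit≤1 : ∀ c → bit c ≤ 1
bit≤1 true  = ≤-refl
bit≤1 false = z≤n

bit-injective : ∀ {b c} → bit b ≡ bit c → b ≡ c
bit-injective {false} {false} _ = refl
bit-injective {true}  {true}  _ = refl

χ-∈ : ∀ {A : Subset n} {a} → a ∈ A → χ A a ≡ 1
χ-∈ = cong bit ∘ []=⇒lookup

∉⇒lookup : ∀ {A : Subset n} {a} → a ∉ A → lookup A a ≡ false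
∉⇒lookup {A = A} {a} a∉A with lookup A a in eq
... | true  = contradiction (lookup⇒[]= a A eq) a∉A
... | false = refl

lookup⇒∉ : ∀ {A : Subset n} {a} → lookup A a ≡ false → a ∉ A
lookup⇒∉ eq a∈A with () ← trans (sym eq) ([]=⇒lookup a∈A)

χ-∉ : ∀ {A : Subset n} {a} → a ∉ A → χ A a ≡ 0
χ-∉ = cong bit ∘ ∉⇒lookup

∩-absorb : (A B : Subset n) → ∣ A ∩ B ∣ ≡ ∣ A ∣ → A ∩ B ≡ A
∩-absorb []          []          e = refl
∩-absorb (true ∷ A)  (true ∷ B)  e = cong (true ∷_) (∩-absorb A B (suc-injective e))
∩-absorb (true ∷ A)  (false ∷ B) e =
  contradiction (≤-trans (≤-reflexive (sym e)) (∣p∩q∣≤∣p∣ A B)) 1+n≰n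
∩-absorb (false ∷ A) (_ ∷ B)     e = cong (false ∷_) (∩-absorb A B e)

∣∩∣<⇒∖ : (A B : Subset n) → ∣ A ∩ B ∣ < ∣ A ∣ → ∃[ a ] a ∈ A × a ∉ B
∣∩∣<⇒∖ (true ∷ A) (true ∷ B) lt with a , a∈A , a∉B ← ∣∩∣<⇒∖ A B (s≤s⁻¹ lt) =
  suc a , there a∈A , a∉B ∘ drop-there
∣∩∣<⇒∖ (true ∷ A) (false ∷ B) lt = zero , here , λ ()
∣∩∣<⇒∖ (false ∷ A) (_ ∷ B) lt with a , a∈A , a∉B ← ∣∩∣<⇒∖ A B lt =
  suc a , there a∈A , a∉B ∘ drop-there

-- The one point of A outside B contributes just its indicator to an intersection with D.
-- Quantifying over D makes this the vector identity A = (A ∩ B) + e_a.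
∖-singleton : (A B : Subset n) → ∣ A ∣ ≡ suc ∣ A ∩ B ∣ →
              ∃[ a ] a ∈ A × a ∉ B × (∀ D → ∣ A ∩ D ∣ ≡ ∣ (A ∩ B) ∩ D ∣ + χ D a)
∖-singleton (true ∷ A) (true ∷ B) e
  with a , a∈A , a∉B , f ← ∖-singleton A B (suc-injective e) =
  suc a , there a∈A , a∉B ∘ drop-there , λ where
    (true ∷ D)  → cong suc (f D)
    (false ∷ D) → f D
∖-singleton (true ∷ A) (false ∷ B) e = zero , here , (λ ()) , λ where
    (true ∷ D)  → trans (cong (suc ∘ ∣_∣ ∘ (_∩ D)) (sym A∩B≡A)) (+-comm 1 _)
    (false ∷ D) → trans (cong (∣_∣ ∘ (_∩ D)) (sym A∩B≡A)) (sym (+-identityʳ _))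
  where A∩B≡A = ∩-absorb A B (sym (suc-injective e))
∖-singleton (false ∷ A) (_ ∷ B) e
  with a , a∈A , a∉B , f ← ∖-singleton A B e =
  suc a , there a∈A , a∉B ∘ drop-there , λ where (_ ∷ D) → f D

∣insert∩∣ : ∀ (C D : Subset n) {a} → a ∉ C → ∣ (C [ a ]≔ true) ∩ D ∣ ≡ ∣ C ∩ D ∣ + χ D a
∣insert∩∣ (true ∷ C)  D           {zero}  a∉C = contradiction here a∉C
∣insert∩∣ (false ∷ C) (true ∷ D)  {zero}  a∉C = +-comm 1 _
∣insert∩∣ (false ∷ C) (false ∷ D) {zero}  a∉C = sym (+-identityʳ _)
∣insert∩∣ (true ∷ C)  (true ∷ D)  {suc a} a∉C = cong suc (∣insert∩∣ C D (a∉C ∘ there))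
∣insert∩∣ (true ∷ C)  (false ∷ D) {suc a} a∉C = ∣insert∩∣ C D (a∉C ∘ there)
∣insert∩∣ (false ∷ C) (_ ∷ D)     {suc a} a∉C = ∣insert∩∣ C D (a∉C ∘ there)

-- Points of V outside U are dropped as long as the rest of V keeps at least i elements; once
-- dropping would leave too few, D is everything that remains of V.
between : ∀ {U V : Subset n} i → U ⊆ V → ∣ U ∣ ≤ i → i ≤ ∣ V ∣ →
          ∃[ D ] U ⊆ D × D ⊆ V × ∣ D ∣ ≡ i
between {U = []} {[]} zero U⊆V _ _ = [] , (λ ()) , (λ ()) , refl
between {U = true ∷ U} {true ∷ V} (suc i) U⊆V lo hi
  with D , U⊆D , D⊆V , e ← between i (drop-∷-⊆ U⊆V) (s≤s⁻¹ lo) (s≤s⁻¹ hi) =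
  true ∷ D , s⊆s U⊆D , s⊆s D⊆V , cong suc e
between {U = true ∷ U} {false ∷ V} i U⊆V lo hi with () ← U⊆V here
between {U = false ∷ U} {false ∷ V} i U⊆V lo hi
  with D , U⊆D , D⊆V , e ← between i (drop-∷-⊆ U⊆V) lo hi =
  false ∷ D , s⊆s U⊆D , s⊆s D⊆V , e
between {U = false ∷ U} {true ∷ V} i U⊆V lo hi with m≤n⇒m<n∨m≡n hi
... | inj₁ i<1+∣V∣
  with D , U⊆D , D⊆V , e ← between i (drop-∷-⊆ U⊆V) lo (s≤s⁻¹ i<1+∣V∣) =
  false ∷ D , s⊆s U⊆D , out⊆ D⊆V , e
... | inj₂ refl = true ∷ V , out⊆ (drop-∷-⊆ U⊆V) , s⊆s ⊆-refl , refl

-- If y were missed, punching it out of the codomain would inject `Fin (suc n)` into `Fin n`.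
injective⇒surjective : {f : Fin n → Fin n} → Injective _≡_ _≡_ f → ∀ y → ∃[ x ] f x ≡ y
injective⇒surjective {n = suc n} {f} inj y with any? (λ x → f x ≟ y)
... | yes p = p
... | no ¬p = contradiction (injective⇒≤ {f = g} (inj ∘ punchOut-injective (y≢f _) (y≢f _))) 1+n≰n
  where
  y≢f : ∀ x → y ≢ f x
  y≢f x e = ¬p (x , sym e)
  g : Fin (suc n) → Fin n
  g x = punchOut (y≢f x)

injective⇒permutation : (f : Fin n → Fin n) → Injective _≡_ _≡_ f →
                        ∃[ θ ] (∀ x → θ ⟨$⟩ʳ x ≡ f x)
injective⇒permutation f inj =
  permutation f (proj₁ ∘ f⁻¹) (proj₂ ∘ f⁻¹) (λ x → inj (proj₂ (f⁻¹ (f x)))) , λ _ → refl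
  where f⁻¹ = injective⇒surjective inj

-- Adjacency, exchanges and distance in J(n,i).

module _ {n i : ℕ} where

  private
    V = JVertex n i
  open Graph (J n i) using (Adj)

  -- |A ∩ D| as an inner product: the vectors of A and B differ by e_a − e_b.
  Differ : (A B : Subset n) (a b : Fin n) → Set
  Differ A B a b = ∀ D → ∣ A ∩ D ∣ + χ D b ≡ ∣ B ∩ D ∣ + χ D a

  vertex-≡ : (A B : V) → ∣ proj₁ A ∩ proj₁ B ∣ ≡ i → A ≡ B
  vertex-≡ (A , ∣A∣≡i) (B , ∣B∣≡i) e = JVertex-≡ (begin
    A      ≡⟨ ∩-absorb A B (trans e (sym ∣A∣≡i)) ⟨
    A ∩ B  ≡⟨ ∩-comm A B ⟩
    B ∩ A  ≡⟨ ∩-absorb B A (trans (cong ∣_∣ (∩-comm B A)) (trans e (sym ∣B∣≡i))) ⟩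
    B      ∎)
    where open ≡-Reasoning

  -- Each of the two sets is A ∩ B with one further point, so the common part cancels and e_a - e_b
  -- is left.
  adjacent⇒differ : (A B : V) → Adj A B → ∃₂ λ a b → a ≢ b × Differ (proj₁ A) (proj₁ B) a b
  adjacent⇒differ (A , ∣A∣≡i) (B , ∣B∣≡i) adj
    with a , a∈A , a∉B , f ← ∖-singleton A B (trans ∣A∣≡i (sym adj))
       | b , b∈B , b∉A , g ← ∖-singleton B A
           (trans ∣B∣≡i (trans (sym adj) (cong (suc ∘ ∣_∣) (∩-comm A B)))) =
    a , b , (λ { refl → b∉A a∈A }) , λ D → begin
      ∣ A ∩ D ∣ + χ D b                  ≡⟨ cong (_+ χ D b) (f D) ⟩
      ∣ (A ∩ B) ∩ D ∣ + χ D a + χ D b    ≡⟨ xy∙z≈xz∙y _ (χ D a) (χ D b) ⟩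
      ∣ (A ∩ B) ∩ D ∣ + χ D b + χ D a    ≡⟨ cong (λ X → ∣ X ∩ D ∣ + χ D b + χ D a) (∩-comm A B) ⟩
      ∣ (B ∩ A) ∩ D ∣ + χ D b + χ D a    ≡⟨ cong (_+ χ D a) (g D) ⟨
      ∣ B ∩ D ∣ + χ D a                  ∎
    where
    open ≡-Reasoning

  exchange : (A : V) {a b : Fin n} → a ∈ proj₁ A → b ∉ proj₁ A →
             ∃[ B ] Adj A B × Differ (proj₁ A) (proj₁ B) a b
  exchange (A , ∣A∣≡i) {a} {b} a∈A b∉A = (B , ∣B∣≡i) , adj , differ
    where
    open ≡-Reasoning
    -- C is the common part: inserting a gives back A and inserting b gives B, so `∣insert∩∣`
    -- evaluates both against any D.
    C = A [ a ]≔ false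
    B = C [ b ]≔ true
    b≢a : b ≢ a
    b≢a refl = b∉A a∈A
    a∉C : a ∉ C
    a∉C = lookup⇒∉ (lookup∘update a A false)
    b∉C : b ∉ C
    b∉C = lookup⇒∉ (trans (lookup∘update′ b≢a A false) (∉⇒lookup b∉A))
    C+a≡A : C [ a ]≔ true ≡ A
    C+a≡A = trans ([]≔-idempotent A a)
                  (trans (cong (A [ a ]≔_) (sym ([]=⇒lookup a∈A))) ([]≔-lookup A a))
    ∣A∩∣ : ∀ D → ∣ A ∩ D ∣ ≡ ∣ C ∩ D ∣ + χ D a
    ∣A∩∣ D = trans (cong (∣_∣ ∘ (_∩ D)) (sym C+a≡A)) (∣insert∩∣ C D a∉C)
    differ : Differ A B a b
    differ D = begin
      ∣ A ∩ D ∣ + χ D b          ≡⟨ cong (_+ χ D b) (∣A∩∣ D) ⟩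
      ∣ C ∩ D ∣ + χ D a + χ D b  ≡⟨ xy∙z≈xz∙y ∣ C ∩ D ∣ (χ D a) (χ D b) ⟩
      ∣ C ∩ D ∣ + χ D b + χ D a  ≡⟨ cong (_+ χ D a) (∣insert∩∣ C D b∉C) ⟨
      ∣ B ∩ D ∣ + χ D a          ∎
    -- Taking D = ⊤ in `differ` compares the sizes of A and B. Taking D = B below gives adjacency,
    -- because b lies in B and a does not.
    ∣B∣≡i : ∣ B ∣ ≡ i
    ∣B∣≡i = trans (+-cancelʳ-≡ 1 _ _ (begin
      ∣ B ∣ + 1          ≡⟨ cong₂ _+_ (cong ∣_∣ (∩-identityʳ B)) (χ-∈ {A = ⊤} {a} ∈⊤) ⟨
      ∣ B ∩ ⊤ ∣ + χ ⊤ a  ≡⟨ differ ⊤ ⟨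
      ∣ A ∩ ⊤ ∣ + χ ⊤ b  ≡⟨ cong₂ _+_ (cong ∣_∣ (∩-identityʳ A)) (χ-∈ {A = ⊤} {b} ∈⊤) ⟩
      ∣ A ∣ + 1          ∎)) ∣A∣≡i
    adj : suc ∣ A ∩ B ∣ ≡ i
    adj = begin
      suc ∣ A ∩ B ∣      ≡⟨ +-comm 1 _ ⟩
      ∣ A ∩ B ∣ + 1      ≡⟨ cong (λ c → ∣ A ∩ B ∣ + bit c) (lookup∘update b C true) ⟨
      ∣ A ∩ B ∣ + χ B b  ≡⟨ differ B ⟩
      ∣ B ∩ B ∣ + χ B a  ≡⟨ cong₂ _+_ (cong ∣_∣ (∩-idem B))
                             (cong bit (trans (lookup∘update′ (b≢a ∘ sym) C true) (∉⇒lookup a∉C))) ⟩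
      ∣ B ∣ + 0          ≡⟨ +-identityʳ _ ⟩
      ∣ B ∣              ≡⟨ ∣B∣≡i ⟩
      i                  ∎

  -- A and B are at distance i − |A ∩ B| in J(n,i), and a graph homomorphism
  -- does not increase distances.
  hom-nonexpansive : (σ : V → V) → (∀ A B → Adj A B → Adj (σ A) (σ B)) →
    ∀ k A B → k + ∣ proj₁ A ∩ proj₁ B ∣ ≡ i → i ≤ k + ∣ proj₁ (σ A) ∩ proj₁ (σ B) ∣
  hom-nonexpansive σ hom zero A B e with refl ← vertex-≡ A B e =
    ≤-reflexive (sym (trans (cong ∣_∣ (∩-idem (proj₁ (σ A)))) (proj₂ (σ A))))
  hom-nonexpansive σ hom (suc k) A₀@(A , ∣A∣≡i) B₀@(B , ∣B∣≡i) e
    with a , a∈A , a∉B ← ∣∩∣<⇒∖ A B (subst (∣ A ∩ B ∣ <_) (trans e (sym ∣A∣≡i)) (s≤s (m≤n+m _ k)))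
       | b , b∈B , b∉A ← ∣∩∣<⇒∖ B A (subst₂ _<_ (cong ∣_∣ (∩-comm A B)) (trans e (sym ∣B∣≡i)) (s≤s (m≤n+m _ k)))
    -- Trading b for a brings B one step closer to A. On the image side σ B moves to a neighbour,
    -- which changes its intersection with σ A by at most one.
    with B₁@(B′ , _) , adj , B-B′ ← exchange B₀ b∈B a∉B
    with x , y , _ , σB-σB′ ← adjacent⇒differ (σ B₀) (σ B₁) (hom B₀ B₁ adj) = begin
      i                                                ≤⟨ hom-nonexpansive σ hom k A₀ B₁ closer ⟩
      k + ∣ proj₁ (σ A₀) ∩ proj₁ (σ B₁) ∣              ≡⟨ cong (λ X → k + ∣ X ∣) (∩-comm (proj₁ (σ A₀)) _) ⟩
      k + ∣ proj₁ (σ B₁) ∩ proj₁ (σ A₀) ∣              ≤⟨ +-monoʳ-≤ k (m≤m+n _ (χ (proj₁ (σ A₀)) x)) ⟩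
      k + (∣ proj₁ (σ B₁) ∩ proj₁ (σ A₀) ∣ + χ (proj₁ (σ A₀)) x)  ≡⟨ cong (k +_) (σB-σB′ (proj₁ (σ A₀))) ⟨
      k + (∣ proj₁ (σ B₀) ∩ proj₁ (σ A₀) ∣ + χ (proj₁ (σ A₀)) y)  ≤⟨ +-monoʳ-≤ k (+-monoʳ-≤ _ (bit≤1 (lookup (proj₁ (σ A₀)) y))) ⟩
      k + (∣ proj₁ (σ B₀) ∩ proj₁ (σ A₀) ∣ + 1)        ≡⟨ shift k _ ⟩
      suc k + ∣ proj₁ (σ B₀) ∩ proj₁ (σ A₀) ∣          ≡⟨ cong (λ X → suc k + ∣ X ∣) (∩-comm (proj₁ (σ B₀)) _) ⟩
      suc k + ∣ proj₁ (σ A₀) ∩ proj₁ (σ B₀) ∣          ∎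
    where
    open ≤-Reasoning
    shift : ∀ x y → x + (y + 1) ≡ suc x + y
    shift = solve-∀
    closer : k + ∣ A ∩ B′ ∣ ≡ i
    closer = trans (cong (k +_) (trans (cong ∣_∣ (∩-comm A B′)) (sym (begin-equality
      ∣ A ∩ B ∣ + 1      ≡⟨ cong₂ _+_ (cong ∣_∣ (∩-comm A B)) (sym (χ-∈ a∈A)) ⟩
      ∣ B ∩ A ∣ + χ A a  ≡⟨ B-B′ A ⟩
      ∣ B′ ∩ A ∣ + χ A b ≡⟨ cong (∣ B′ ∩ A ∣ +_) (χ-∉ b∉A) ⟩
      ∣ B′ ∩ A ∣ + 0     ≡⟨ +-identityʳ _ ⟩
      ∣ B′ ∩ A ∣         ∎)))) (trans (shift k _) e)

  -- `hom-nonexpansive` for σ and for its inverse gives the two inequalities; the inverse preserves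
  -- adjacency by the converse half of `Aut`.
  aut-isometry : ∀ {σ} → Aut (J n i) σ → ∀ A B →
    ∣ proj₁ (Inverse.to σ A) ∩ proj₁ (Inverse.to σ B) ∣ ≡ ∣ proj₁ A ∩ proj₁ B ∣
  aut-isometry {σ} aut A B = ≤-antisym
    (subst (λ m → ∣ proj₁ (to A) ∩ proj₁ (to B) ∣ ≤ m)
      (cong₂ (λ X Y → ∣ proj₁ X ∩ proj₁ Y ∣) (strictlyInverseʳ A) (strictlyInverseʳ B))
      (grow from (λ X Y adj → Equivalence.from (aut (from X) (from Y))
                   (subst₂ Adj (sym (strictlyInverseˡ X)) (sym (strictlyInverseˡ Y)) adj))
            (to A) (to B)))
    (grow to (λ X Y → Equivalence.to (aut X Y)) A B)
    where
    open Inverse σ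
    grow : (τ : V → V) → (∀ A B → Adj A B → Adj (τ A) (τ B)) → ∀ A B →
           ∣ proj₁ A ∩ proj₁ B ∣ ≤ ∣ proj₁ (τ A) ∩ proj₁ (τ B) ∣
    grow τ hom A B = +-cancelˡ-≤ (i ∸ ∣ proj₁ A ∩ proj₁ B ∣) _ _
      (≤-trans (≤-reflexive e) (hom-nonexpansive τ hom _ A B e))
      where
      e = m∸n+n≡m (≤-trans (∣p∩q∣≤∣p∣ (proj₁ A) (proj₁ B)) (≤-reflexive (proj₂ A)))

  Aut-isSubgroup : IsSubgroup (Sym V) (Aut (J n i))
  Aut-isSubgroup = record
    { resp-≈    = λ σ≈τ aut A B → subst₂ (λ X Y → Adj A B ⇔ Adj X Y) (σ≈τ A) (σ≈τ B) (aut A B)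
    ; ε-closed  = λ A B → mk⇔ (λ e → e) (λ e → e)
    ; ∙-closed  = λ {σ} {τ} autσ autτ A B → autσ (Inverse.to τ A) (Inverse.to τ B) ⇔-∘ autτ A B
    ; ⁻¹-closed = λ {σ} aut A B → subst₂ (λ X Y → Adj X Y ⇔ Adj (Inverse.from σ A) (Inverse.from σ B))
        (Inverse.strictlyInverseˡ σ A) (Inverse.strictlyInverseˡ σ B)
        (⇔-sym (aut (Inverse.from σ A) (Inverse.from σ B)))
    }

-- Intersections and cardinalities under images, complements and unions.

image-∩ : (θ : Permutation′ n) (A B : Subset n) →
          image (θ ⟨$⟩ʳ_) A ∩ image (θ ⟨$⟩ʳ_) B ≡ image (θ ⟨$⟩ʳ_) (A ∩ B)
image-∩ θ A B = lookup-ext λ y → begin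
  lookup (image (θ ⟨$⟩ʳ_) A ∩ image (θ ⟨$⟩ʳ_) B) y                   ≡⟨ lookup-zipWith _∧_ y (image (θ ⟨$⟩ʳ_) A) _ ⟩
  lookup (image (θ ⟨$⟩ʳ_) A) y ∧ lookup (image (θ ⟨$⟩ʳ_) B) y        ≡⟨ cong₂ _∧_ (lookup-image θ A y) (lookup-image θ B y) ⟩
  lookup A (θ ⟨$⟩ˡ y) ∧ lookup B (θ ⟨$⟩ˡ y)                          ≡⟨ lookup-zipWith _∧_ (θ ⟨$⟩ˡ y) A B ⟨
  lookup (A ∩ B) (θ ⟨$⟩ˡ y)                                          ≡⟨ lookup-image θ (A ∩ B) y ⟨
  lookup (image (θ ⟨$⟩ʳ_) (A ∩ B)) y                                 ∎
  where open ≡-Reasoning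

-- Inclusion-exclusion, arranged without subtraction. For |A| = |B| = i and n = 2i the extra terms
-- cancel, which is why complementation preserves intersection sizes.
∣∁∩∁∣ : (A B : Subset n) → ∣ ∁ A ∩ ∁ B ∣ + (∣ A ∣ + ∣ B ∣) ≡ n + ∣ A ∩ B ∣
∣∁∩∁∣ []          []          = refl
∣∁∩∁∣ (false ∷ A) (false ∷ B) = cong suc (∣∁∩∁∣ A B)
∣∁∩∁∣ (false ∷ A) (true ∷ B)  =
  trans (cong (∣ ∁ A ∩ ∁ B ∣ +_) (+-suc ∣ A ∣ ∣ B ∣)) (trans (+-suc _ _) (cong suc (∣∁∩∁∣ A B)))
∣∁∩∁∣ (true ∷ A)  (false ∷ B) = trans (+-suc _ _) (cong suc (∣∁∩∁∣ A B))
∣∁∩∁∣ {suc n} (true ∷ A)  (true ∷ B)  =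
  trans (+-suc ∣ ∁ A ∩ ∁ B ∣ _) (cong suc
    (trans (cong (∣ ∁ A ∩ ∁ B ∣ +_) (+-suc ∣ A ∣ ∣ B ∣))
    (trans (+-suc _ _) (trans (cong suc (∣∁∩∁∣ A B)) (sym (+-suc n _))))))

∣∩∣+∣∁∩∣ : (A B : Subset n) → ∣ A ∩ B ∣ + ∣ ∁ A ∩ B ∣ ≡ ∣ B ∣
∣∩∣+∣∁∩∣ []          []          = refl
∣∩∣+∣∁∩∣ (true ∷ A)  (true ∷ B)  = cong suc (∣∩∣+∣∁∩∣ A B)
∣∩∣+∣∁∩∣ (false ∷ A) (true ∷ B)  = trans (+-suc _ _) (cong suc (∣∩∣+∣∁∩∣ A B))
∣∩∣+∣∁∩∣ (true ∷ A)  (false ∷ B) = ∣∩∣+∣∁∩∣ A B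
∣∩∣+∣∁∩∣ (false ∷ A) (false ∷ B) = ∣∩∣+∣∁∩∣ A B

∣∪∣≤ : (A B : Subset n) → ∣ A ∪ B ∣ ≤ ∣ A ∣ + ∣ B ∣
∣∪∣≤ []          []          = z≤n
∣∪∣≤ (true ∷ A)  (true ∷ B)  = s≤s (≤-trans (∣∪∣≤ A B) (+-monoʳ-≤ ∣ A ∣ (n≤1+n _)))
∣∪∣≤ (true ∷ A)  (false ∷ B) = s≤s (∣∪∣≤ A B)
∣∪∣≤ (false ∷ A) (true ∷ B)  = ≤-trans (s≤s (∣∪∣≤ A B)) (≤-reflexive (sym (+-suc ∣ A ∣ ∣ B ∣)))
∣∪∣≤ (false ∷ A) (false ∷ B) = ∣∪∣≤ A B

∣pair∣≤2 : (p q : Fin n) → ∣ ⁅ p ⁆ ∪ ⁅ q ⁆ ∣ ≤ 2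
∣pair∣≤2 p q = ≤-trans (∣∪∣≤ ⁅ p ⁆ ⁅ q ⁆) (≤-reflexive (cong₂ _+_ (∣⁅x⁆∣≡1 p) (∣⁅x⁆∣≡1 q)))

χ-∁ : (A : Subset n) (a : Fin n) → χ (∁ A) a + χ A a ≡ 1
χ-∁ A a rewrite lookup-map a not A with lookup A a
... | true  = refl
... | false = refl

-- The action of an isometry on the roots e_a - e_b.

module _ {n i : ℕ} (2≤i : 2 ≤ i) (2+i≤n : 2 + i ≤ n) where

  private
    V = JVertex n i

  -- Since 2 ≤ i ≤ n - 2, an i-set fits between {p, q} and the complement of {r, s}. The points p
  -- and q may coincide, and so may r and s, so two single points are covered too.
  separate : {p q r s : Fin n} → p ≢ r → p ≢ s → q ≢ r → q ≢ s →
             ∃[ D ] p ∈ proj₁ D × q ∈ proj₁ D × r ∉ proj₁ D × s ∉ proj₁ {B = λ A → ∣ A ∣ ≡ i} D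
  separate {p} {q} {r} {s} p≢r p≢s q≢r q≢s =
    let D , U⊆D , D⊆W , ∣D∣≡i = between i U⊆W (≤-trans (∣pair∣≤2 p q) 2≤i) large in
    (D , ∣D∣≡i) ,
    U⊆D (x∈p∪q⁺ (inj₁ (x∈⁅x⁆ p))) ,
    U⊆D (x∈p∪q⁺ (inj₂ (x∈⁅x⁆ q))) ,
    (λ r∈D → x∈∁p⇒x∉p (D⊆W r∈D) (x∈p∪q⁺ (inj₁ (x∈⁅x⁆ r)))) ,
    (λ s∈D → x∈∁p⇒x∉p (D⊆W s∈D) (x∈p∪q⁺ (inj₂ (x∈⁅x⁆ s))))
    where
    large : i ≤ ∣ ∁ (⁅ r ⁆ ∪ ⁅ s ⁆) ∣
    large = begin
      i                              ≤⟨ ∸-monoˡ-≤ 2 2+i≤n ⟩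
      n ∸ 2                          ≤⟨ ∸-monoʳ-≤ n (∣pair∣≤2 r s) ⟩
      n ∸ ∣ ⁅ r ⁆ ∪ ⁅ s ⁆ ∣          ≡⟨ ∣∁p∣≡n∸∣p∣ (⁅ r ⁆ ∪ ⁅ s ⁆) ⟨
      ∣ ∁ (⁅ r ⁆ ∪ ⁅ s ⁆) ∣          ∎
      where open ≤-Reasoning
    avoid : ∀ {x} → x ≢ r → x ≢ s → x ∈ ∁ (⁅ r ⁆ ∪ ⁅ s ⁆)
    avoid x≢r x≢s = x∉p⇒x∈∁p λ x∈ →
      [ x≢r ∘ x∈⁅y⁆⇒x≡y r , x≢s ∘ x∈⁅y⁆⇒x≡y s ]′ (x∈p∪q⁻ ⁅ r ⁆ ⁅ s ⁆ x∈)
    U⊆W : ⁅ p ⁆ ∪ ⁅ q ⁆ ⊆ ∁ (⁅ r ⁆ ∪ ⁅ s ⁆)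
    U⊆W x∈ with x∈p∪q⁻ ⁅ p ⁆ ⁅ q ⁆ x∈
    ... | inj₁ x∈p rewrite x∈⁅y⁆⇒x≡y p x∈p = avoid p≢r p≢s
    ... | inj₂ x∈q rewrite x∈⁅y⁆⇒x≡y q x∈q = avoid q≢r q≢s

  χ-separates : {a b : Fin n} → (∀ (D : V) → χ (proj₁ D) a ≡ χ (proj₁ D) b) → a ≡ b
  χ-separates {a} {b} e = decidable-stable (a ≟ b) λ a≢b →
    let D , a∈D , _ , b∉D , _ = separate a≢b a≢b a≢b a≢b
    in 1+n≢0 (trans (sym (χ-∈ a∈D)) (trans (e D) (χ-∉ b∉D)))

  -- σ, extended linearly, sends the root e_a − e_b to e_x − e_y; both sides of
  -- ⟨e_x − e_y , σ D⟩ = ⟨e_a − e_b , D⟩ are moved so that no subtraction occurs.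
  RootMap : (V → V) → (a b x y : Fin n) → Set
  RootMap σ a b x y = ∀ D →
    χ (proj₁ (σ D)) x + χ (proj₁ D) b ≡ χ (proj₁ (σ D)) y + χ (proj₁ D) a

  -- The root e_a - e_b is the difference of adjacent vertices A and B. Their images are again
  -- adjacent, so they differ by a root, whose pairing with σ D is computed by the isometry.
  isometry⇒rootMap : (σ : V → V) →
    (∀ A B → ∣ proj₁ (σ A) ∩ proj₁ (σ B) ∣ ≡ ∣ proj₁ A ∩ proj₁ B ∣) →
    ∀ {a b} → a ≢ b → ∃₂ λ x y → x ≢ y × RootMap σ a b x y
  isometry⇒rootMap σ isom {a} {b} a≢b
    with A , a∈A , _ , b∉A , _ ← separate a≢b a≢b a≢b a≢b
    with B , adj , A-B ← exchange A a∈A b∉A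
    with x , y , x≢y , σA-σB ← adjacent⇒differ (σ A) (σ B)
           (trans (cong suc (isom A B)) adj) =
    x , y , x≢y , λ D → cancel ∣ proj₁ A ∩ proj₁ D ∣ ∣ proj₁ B ∩ proj₁ D ∣
      (χ (proj₁ D) a) (χ (proj₁ D) b) (χ (proj₁ (σ D)) x) (χ (proj₁ (σ D)) y) (A-B (proj₁ D))
      (trans (cong (_+ χ (proj₁ (σ D)) y) (sym (isom A D)))
        (trans (σA-σB (proj₁ (σ D))) (cong (_+ χ (proj₁ (σ D)) x) (isom B D))))
    where
    -- Here k = |A ∩ D| and l = |B ∩ D|, which the isometry makes common to both relations; adding
    -- the relations crosswise eliminates them.
    cancel : ∀ k l α β α′ β′ → k + β ≡ l + α → k + β′ ≡ l + α′ → α′ + β ≡ β′ + α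
    cancel k l α β α′ β′ e e′ = +-cancelˡ-≡ (k + l) _ _ (begin
      (k + l) + (α′ + β)  ≡⟨ lhs k l α′ β ⟩
      (k + β) + (l + α′)  ≡⟨ cong₂ _+_ e (sym e′) ⟩
      (l + α) + (k + β′)  ≡⟨ rhs k l α β′ ⟩
      (k + l) + (β′ + α)  ∎)
      where
      open ≡-Reasoning
      lhs : ∀ k l a b → (k + l) + (a + b) ≡ (k + b) + (l + a)
      lhs = solve-∀
      rhs : ∀ k l a b → (l + a) + (k + b) ≡ (k + l) + (b + a)
      rhs = solve-∀

  -- The two relations have the same right-hand side, so b and c belong to the same vertices.
  rootMap-injective : ∀ σ {o b c x y} → RootMap σ o b x y → RootMap σ o c x y → b ≡ c
  rootMap-injective σ {x = x} rb rc = χ-separates λ D →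
    +-cancelˡ-≡ (χ (proj₁ (σ D)) x) _ _ (trans (rb D) (sym (rc D)))

  -- Otherwise some vertex contains x and y′ but not y and x′, so that
  -- (e_x − e_y) − (e_x′ − e_y′) takes the value 2 there, while e_c − e_b is at most 1.
  roots-share-end : (σ : V ↔ V) → ∀ {o b c x y x′ y′} → x ≢ y → x′ ≢ y′ →
    RootMap (Inverse.to σ) o b x y → RootMap (Inverse.to σ) o c x′ y′ → x ≡ x′ ⊎ y ≡ y′
  roots-share-end σ {o} {b} {c} {x} {y} {x′} {y′} x≢y x′≢y′ rb rc with x ≟ x′ | y ≟ y′
  ... | yes x≡x′ | _        = inj₁ x≡x′
  ... | no  _    | yes y≡y′ = inj₂ y≡y′
  ... | no  x≢x′ | no  y≢y′
    with E , x∈E , y′∈E , y∉E , x′∉E ← separate x≢y x≢x′ (y≢y′ ∘ sym) (x′≢y′ ∘ sym) =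
    contradiction₂ (lookup D o) (lookup D b) (lookup D c)
      (at rb (χ-∈ x∈E) (χ-∉ y∉E)) (at rc (χ-∉ x′∉E) (χ-∈ y′∈E))
    where
    -- `RootMap` speaks of images under σ, so E is pulled back; surjectivity of σ enters here.
    D = proj₁ (Inverse.from σ E)
    at : ∀ {d u v k l} → RootMap (Inverse.to σ) o d u v → χ (proj₁ E) u ≡ k → χ (proj₁ E) v ≡ l →
         k + χ D d ≡ l + χ D o
    at {d} {u} {v} r refl refl =
      subst (λ F → χ (proj₁ F) u + χ D d ≡ χ (proj₁ F) v + χ D o)
        (Inverse.strictlyInverseˡ σ E) (r (Inverse.from σ E))
    -- The first equation forces o into D, and the second then asks the indicator of c to be 2.
    contradiction₂ : ∀ {A : Set} p q r → 1 + bit q ≡ bit p → bit r ≡ 1 + bit p → A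
    contradiction₂ true true _ ()
    contradiction₂ true false true _ ()
    contradiction₂ true false false _ ()
    contradiction₂ false _ _ ()

  -- Distinct roots have distinct images, so f is injective and hence a permutation θ. The indicator
  -- of σ D read along f then agrees with that of D, which makes σ D the image of D under θ.
  rootMaps⇒ρ : (σ : V → V) (f : Fin n → Fin n) (o : Fin n) →
    (∀ b → RootMap σ o b (f o) (f b)) → ∃[ θ ] (∀ D → σ D ≡ Inverse.to (ρ n i θ) D)
  rootMaps⇒ρ σ f o root = θ , λ D → JVertex-≡ (lookup-ext λ y → begin
      lookup (proj₁ (σ D)) y                ≡⟨ cong (lookup (proj₁ (σ D))) (trans (sym (θ≗f _)) (inverseʳ θ)) ⟨
      lookup (proj₁ (σ D)) (f (θ ⟨$⟩ˡ y))   ≡⟨ bit-injective (pointwise D (θ ⟨$⟩ˡ y)) ⟩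
      lookup (proj₁ D) (θ ⟨$⟩ˡ y)           ≡⟨ lookup-image θ (proj₁ D) y ⟨
      lookup (image (θ ⟨$⟩ʳ_) (proj₁ D)) y  ∎)
    where
    open ≡-Reasoning
    f-injective : Injective _≡_ _≡_ f
    f-injective {b} {c} fb≡fc = rootMap-injective σ (root b)
      (subst (RootMap σ o c (f o)) (sym fb≡fc) (root c))
    θ = proj₁ (injective⇒permutation f f-injective)
    θ≗f = proj₂ (injective⇒permutation f f-injective)
    member : ∀ (D : V) → ∃[ a ] a ∈ proj₁ D
    member (D , ∣D∣≡i) =
      let a , a∈D , _ = ∣∩∣<⇒∖ D ⊥ (subst₂ _<_ (sym (trans (cong ∣_∣ (∩-zeroʳ D)) (∣⊥∣≡0 n)))
                          (sym ∣D∣≡i) (≤-trans (s≤s z≤n) 2≤i))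
      in a , a∈D
    nonmember : ∀ (D : V) → ∃[ a ] a ∉ proj₁ D
    nonmember (D , ∣D∣≡i) =
      let a , _ , a∉D = ∣∩∣<⇒∖ ⊤ D (subst₂ _<_ (sym (trans (cong ∣_∣ (∩-identityˡ D)) ∣D∣≡i))
                          (sym (∣⊤∣≡n n)) (≤-trans (n≤1+n _) 2+i≤n))
      in a , a∉D
    -- σ D ∘ f − D is constant; the constant vanishes because D is neither empty nor full.
    offset : ∀ (D : V) (E : Fin n → Bool) c d →
             (∀ b → bit c + χ (proj₁ D) b ≡ bit (E b) + bit d) → bit c ≡ bit d
    offset D E true  true  e = refl
    offset D E false false e = refl
    offset D E true  false e with a , a∈D ← member D =
      contradiction (subst (_≤ 1) (trans (sym (+-identityʳ _)) (trans (sym (e a)) (cong suc (χ-∈ a∈D)))) (bit≤1 (E a))) 1+n≰n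
    offset D E false true  e with a , a∉D ← nonmember D =
      contradiction (trans (+-comm 1 _) (trans (sym (e a)) (χ-∉ a∉D))) 1+n≢0
    pointwise : ∀ D b → χ (proj₁ (σ D)) (f b) ≡ χ (proj₁ D) b
    pointwise D b = +-cancelʳ-≡ (χ (proj₁ D) o) _ _ (begin
      χ (proj₁ (σ D)) (f b) + χ (proj₁ D) o   ≡⟨ root b D ⟨
      χ (proj₁ (σ D)) (f o) + χ (proj₁ D) b   ≡⟨ cong (_+ χ (proj₁ D) b) (offset D (lookup (proj₁ (σ D)) ∘ f)
                                                   (lookup (proj₁ (σ D)) (f o)) (lookup (proj₁ D) o) (λ b → root b D)) ⟩
      χ (proj₁ D) o + χ (proj₁ D) b           ≡⟨ +-comm (χ (proj₁ D) o) _ ⟩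
      χ (proj₁ D) b + χ (proj₁ D) o           ∎)

-- The pairs 0 and 1 decide which coordinate is shared, say X. If another pair met both of them only
-- in Y, the pairs 0 and 1 would agree in both coordinates, against distinctness.
same-end : ∀ {A : Set} {m} (X Y : Fin (2 + m) → A) →
  (∀ j k → X j ≡ X k ⊎ Y j ≡ Y k) → (∀ j k → X j ≡ X k → Y j ≡ Y k → j ≡ k) →
  (∀ k → X k ≡ X zero) ⊎ (∀ k → Y k ≡ Y zero)
same-end X Y share distinct with share zero (suc zero)
... | inj₁ X₀≡X₁ = inj₁ λ k → case-on k (share k zero) (share k (suc zero))
  where
  case-on : ∀ k → _ ⊎ _ → _ ⊎ _ → X k ≡ X zero
  case-on k (inj₁ e)  _         = e
  case-on k (inj₂ _)  (inj₁ e)  = trans e (sym X₀≡X₁)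
  case-on k (inj₂ e₀) (inj₂ e₁) with () ← distinct zero (suc zero) X₀≡X₁ (trans (sym e₀) e₁)
... | inj₂ Y₀≡Y₁ = inj₂ λ k → case-on k (share k zero) (share k (suc zero))
  where
  case-on : ∀ k → _ ⊎ _ → _ ⊎ _ → Y k ≡ Y zero
  case-on k (inj₂ e)  _         = e
  case-on k (inj₁ _)  (inj₂ e)  = trans e (sym Y₀≡Y₁)
  case-on k (inj₁ e₀) (inj₁ e₁) with () ← distinct zero (suc zero) (trans (sym e₀) e₁) Y₀≡Y₁

-- Passing from D to its complement replaces indicator values u by 1 - u, which reverses the sign of
-- a root; so the two ends p and q trade places.
p+u≡q+v⇒q+u′≡p+v′ : ∀ {p q u u′ v v′} → u′ + u ≡ 1 → v′ + v ≡ 1 → p + u ≡ q + v → q + u′ ≡ p + v′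
p+u≡q+v⇒q+u′≡p+v′ {p} {q} {u} {u′} {v} {v′} eu ev e = +-cancelʳ-≡ (u + v) _ _ (begin
  (q + u′) + (u + v)  ≡⟨ lhs q u′ u v ⟩
  (q + v) + (u′ + u)  ≡⟨ cong₂ _+_ (sym e) (trans eu (sym ev)) ⟩
  (p + u) + (v′ + v)  ≡⟨ rhs p v′ u v ⟩
  (p + v′) + (u + v)  ∎)
  where
  open ≡-Reasoning
  lhs : ∀ q u′ u v → (q + u′) + (u + v) ≡ (q + v) + (u′ + u)
  lhs = solve-∀
  rhs : ∀ p v′ u v → (p + u) + (v′ + v) ≡ (p + v′) + (u + v)
  rhs = solve-∀

2≤i⇒2+i≤2*i : ∀ {i} → 2 ≤ i → 2 + i ≤ 2 * i
2≤i⇒2+i≤2*i {i} 2≤i = +-mono-≤ 2≤i (≤-reflexive (sym (+-identityʳ i)))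

-- Classification of the automorphisms for n = 2i.

module _ (k : ℕ) where

  private
    i = 3 + k
    V = JVertex (2 * i) i
    2≤i : 2 ≤ i
    2≤i = s≤s (s≤s z≤n)
    2+i≤2i : 2 + i ≤ 2 * i
    2+i≤2i = 2≤i⇒2+i≤2*i 2≤i

  aut⇒ρ⊎ρT : (σ : V ↔ V) → Aut (J (2 * i) i) σ →
    (∃[ θ ] (∀ D → Inverse.to σ D ≡ Inverse.to (ρ (2 * i) i θ) D)) ⊎
    (∃[ θ ] (∀ D → Inverse.to σ (Inverse.to (T i) D) ≡ Inverse.to (ρ (2 * i) i θ) D))
  aut⇒ρ⊎ρT σ aut = [ inj₁ ∘ positive , inj₂ ∘ negative ]′ (same-end X Y
      (λ b c → roots-share-end 2≤i 2+i≤2i σ (X≢Y b) (X≢Y c) (root b) (root c))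
      (λ b c X≡ Y≡ → Fin.suc-injective (rootMap-injective 2≤i 2+i≤2i (Inverse.to σ) (root b)
        (subst₂ (Root zero (suc c)) (sym X≡) (sym Y≡) (root c)))))
    where
    Root = RootMap 2≤i 2+i≤2i (Inverse.to σ)
    image-root : ∀ b → ∃₂ λ x y → x ≢ y × Root zero (suc b) x y
    image-root b = isometry⇒rootMap 2≤i 2+i≤2i (Inverse.to σ) (aut-isometry {σ = σ} aut) λ ()
    -- The index bound is the predecessor of `2 * i` as it computes; b stands for the nonzero point
    -- `suc b`.
    X Y : Fin (2 + (k + (i + 0))) → Fin (2 * i)
    X b = proj₁ (image-root b)
    Y b = proj₁ (proj₂ (image-root b))
    X≢Y : ∀ b → X b ≢ Y b
    X≢Y b = proj₁ (proj₂ (proj₂ (image-root b)))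
    root : ∀ b → Root zero (suc b) (X b) (Y b)
    root b = proj₂ (proj₂ (proj₂ (image-root b)))
    positive : (∀ b → X b ≡ X zero) → ∃[ θ ] (∀ D → Inverse.to σ D ≡ Inverse.to (ρ (2 * i) i θ) D)
    positive X≡ = rootMaps⇒ρ 2≤i 2+i≤2i (Inverse.to σ) f zero f-root
      where
      f : Fin (2 * i) → Fin (2 * i)
      -- The shared positive end is the image of 0, and the negative ends are the images of the
      -- other points.
      f zero    = X zero
      f (suc b) = Y b
      f-root : ∀ b → Root zero b (f zero) (f b)
      f-root zero    D = refl
      f-root (suc b) = subst (λ x → Root zero (suc b) x (Y b)) (X≡ b) (root b)
    negative : (∀ b → Y b ≡ Y zero) →
      ∃[ θ ] (∀ D → Inverse.to σ (Inverse.to (T i) D) ≡ Inverse.to (ρ (2 * i) i θ) D)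
    negative Y≡ = rootMaps⇒ρ 2≤i 2+i≤2i (Inverse.to σ ∘ Inverse.to (T i)) f zero f-root
      where
      f : Fin (2 * i) → Fin (2 * i)
      -- Precomposing with T negates every root, so the shared negative end becomes the positive
      -- one.
      f zero    = Y zero
      f (suc b) = X b
      f-root : ∀ b → RootMap 2≤i 2+i≤2i (Inverse.to σ ∘ Inverse.to (T i)) zero b (f zero) (f b)
      f-root zero    D = refl
      f-root (suc b) D = p+u≡q+v⇒q+u′≡p+v′
        {p = χ (proj₁ (Inverse.to σ (Inverse.to (T i) D))) (X b)}
        (trans (+-comm (χ (proj₁ D) (suc b)) _) (χ-∁ (proj₁ D) (suc b)))
        (trans (+-comm (χ (proj₁ D) zero) _) (χ-∁ (proj₁ D) zero))
        (subst (λ y → Root zero (suc b) (X b) y) (Y≡ b) (root b) (Inverse.to (T i) D))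

-- Generated subgroups, centralizers and direct products.

module _ {c ℓ} (G : Group c ℓ) where
  open Group G renaming (refl to ≈-refl; sym to ≈-sym; trans to ≈-trans)
  open GroupProperties G
  open SetoidReasoning setoid

  -- ⟨t⟩ is the least subgroup containing t. Claims about all of ⟨T⟩ thus reduce to T lying in a
  -- suitable subgroup: `Aut`, its centralizer, or {ε, T}.
  generated-⊑ : ∀ {p} {H : Pred Carrier p} {t} → IsSubgroup G H → H t → Generated G t ⊑ H
  generated-⊑ H-sub t∈H gen          = t∈H
  generated-⊑ H-sub t∈H (resp e x)   = IsSubgroup.resp-≈ H-sub e (generated-⊑ H-sub t∈H x)
  generated-⊑ H-sub t∈H unit         = IsSubgroup.ε-closed H-sub
  generated-⊑ H-sub t∈H (mult x y)   =
    IsSubgroup.∙-closed H-sub (generated-⊑ H-sub t∈H x) (generated-⊑ H-sub t∈H y)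
  generated-⊑ H-sub t∈H (invert x)   = IsSubgroup.⁻¹-closed H-sub (generated-⊑ H-sub t∈H x)

  Generated-isSubgroup : ∀ {t} → IsSubgroup G (Generated G t)
  Generated-isSubgroup = record
    { resp-≈ = resp ; ε-closed = unit ; ∙-closed = mult ; ⁻¹-closed = invert }

  centralizer-isSubgroup : ∀ {p} (P : Pred Carrier p) →
                           IsSubgroup G (λ x → ∀ {g} → P g → g ∙ x ≈ x ∙ g)
  centralizer-isSubgroup P = record
    { resp-≈    = λ x≈y comm g∈P → ≈-trans (∙-congˡ (≈-sym x≈y)) (≈-trans (comm g∈P) (∙-congʳ x≈y))
    ; ε-closed  = λ _ → ≈-trans (identityʳ _) (≈-sym (identityˡ _))
    ; ∙-closed  = λ {x} {y} commˣ commʸ {g} g∈P → begin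
        g ∙ (x ∙ y)  ≈⟨ assoc g x y ⟨
        g ∙ x ∙ y    ≈⟨ ∙-congʳ (commˣ g∈P) ⟩
        x ∙ g ∙ y    ≈⟨ assoc x g y ⟩
        x ∙ (g ∙ y)  ≈⟨ ∙-congˡ (commʸ g∈P) ⟩
        x ∙ (y ∙ g)  ≈⟨ assoc x y g ⟨
        x ∙ y ∙ g    ∎
    ; ⁻¹-closed = λ {x} comm {g} g∈P → ∙-cancelˡ x _ _ (begin
        x ∙ (g ∙ x ⁻¹)    ≈⟨ assoc x g (x ⁻¹) ⟨
        x ∙ g ∙ x ⁻¹      ≈⟨ ∙-congʳ (comm g∈P) ⟨
        g ∙ x ∙ x ⁻¹      ≈⟨ //-rightDividesʳ x g ⟩
        g                 ≈⟨ \\-leftDividesˡ x g ⟨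
        x ∙ (x ⁻¹ ∙ g)    ∎)
    }

  -- An involution is its own inverse, so {ε, t} is closed; this splits membership in ⟨t⟩ into two
  -- cases.
  involution-isSubgroup : ∀ {t} → t ∙ t ≈ ε → IsSubgroup G (λ x → x ≈ ε ⊎ x ≈ t)
  involution-isSubgroup {t} t² = record
    { resp-≈    = λ { x≈y (inj₁ e) → inj₁ (≈-trans (≈-sym x≈y) e)
                    ; x≈y (inj₂ e) → inj₂ (≈-trans (≈-sym x≈y) e) }
    ; ε-closed  = inj₁ ≈-refl
    ; ∙-closed  = λ { (inj₁ e) (inj₁ f) → inj₁ (≈-trans (∙-cong e f) (identityˡ ε))
                    ; (inj₁ e) (inj₂ f) → inj₂ (≈-trans (∙-cong e f) (identityˡ t))
                    ; (inj₂ e) (inj₁ f) → inj₂ (≈-trans (∙-cong e f) (identityʳ t))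
                    ; (inj₂ e) (inj₂ f) → inj₁ (≈-trans (∙-cong e f) t²) }
    ; ⁻¹-closed = λ { (inj₁ e) → inj₁ (≈-trans (⁻¹-cong e) ε⁻¹≈ε)
                    ; (inj₂ e) → inj₂ (≈-trans (⁻¹-cong e) (≈-sym (inverseˡ-unique t t t²))) }
    }

  -- Write g = hk. Since k commutes with H, conjugating H by g is conjugating it by h; conjugation
  -- by g fixes K pointwise.
  central⇒internalDirectProduct : ∀ {p q r} {P : Pred Carrier p} {H : Pred Carrier q} {K : Pred Carrier r} →
    IsSubgroup G P → IsSubgroup G H → IsSubgroup G K → H ⊑ P → K ⊑ P →
    (∀ {g k} → P g → K k → g ∙ k ≈ k ∙ g) → (∀ {x} → H x → K x → x ≈ ε) →
    (∀ {x} → P x → ∃₂ λ h k → H h × K k × x ≈ h ∙ k) → IsInternalDirectProduct G P H K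
  central⇒internalDirectProduct {H = H} P-sub H-sub K-sub H⊆P K⊆P central H∩K P⊆HK = record
    { P-isSubgroup = P-sub
    ; H-isSubgroup = H-sub
    ; K-isSubgroup = K-sub
    ; H⊆P          = H⊆P
    ; K⊆P          = K⊆P
    ; H-normal     = normal
    ; K-normal     = λ {g} {k} g∈P k∈K → IsSubgroup.resp-≈ K-sub
        (≈-sym (≈-trans (∙-congʳ (central g∈P k∈K)) (//-rightDividesʳ g k))) k∈K
    ; H∩K-trivial  = H∩K
    ; P⊆HK         = P⊆HK
    }
    where
    module H = IsSubgroup H-sub
    normal : ∀ {g x} → _ → H x → H (g ∙ x ∙ g ⁻¹)
    normal {g} {x} g∈P x∈H with h , k , h∈H , k∈K , g≈hk ← P⊆HK g∈P =
      H.resp-≈ (≈-sym (begin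
        g ∙ x ∙ g ⁻¹                  ≈⟨ ∙-cong (∙-congʳ g≈hk) (⁻¹-cong g≈hk) ⟩
        h ∙ k ∙ x ∙ (h ∙ k) ⁻¹        ≈⟨ ∙-congʳ (assoc h k x) ⟩
        h ∙ (k ∙ x) ∙ (h ∙ k) ⁻¹      ≈⟨ ∙-congʳ (∙-congˡ (central (H⊆P x∈H) k∈K)) ⟨
        h ∙ (x ∙ k) ∙ (h ∙ k) ⁻¹      ≈⟨ ∙-cong (≈-sym (assoc h x k)) (⁻¹-anti-homo-∙ h k) ⟩
        h ∙ x ∙ k ∙ (k ⁻¹ ∙ h ⁻¹)     ≈⟨ assoc (h ∙ x ∙ k) (k ⁻¹) (h ⁻¹) ⟨
        h ∙ x ∙ k ∙ k ⁻¹ ∙ h ⁻¹       ≈⟨ ∙-congʳ (//-rightDividesʳ k (h ∙ x)) ⟩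
        h ∙ x ∙ h ⁻¹                  ∎))
      (H.∙-closed (H.∙-closed h∈H x∈H) (H.⁻¹-closed h∈H))

-- The faithful action of S_n on vertices.

module _ (n i : ℕ) where

  private
    V = JVertex n i
  open Group (Sym V) using (_≈_; _⁻¹; ⁻¹-cong)

  -- Membership in an image is read through the inverse permutation, so the agreement of θ and π is
  -- first carried over to their inverses.
  ρ-cong : ∀ {θ π : Permutation′ n} → (∀ x → θ ⟨$⟩ʳ x ≡ π ⟨$⟩ʳ x) → ρ n i θ ≈ ρ n i π
  ρ-cong {θ} {π} θ≈π (A , _) = JVertex-≡ (lookup-ext λ y → begin
    lookup (image (θ ⟨$⟩ʳ_) A) y  ≡⟨ lookup-image θ A y ⟩
    lookup A (θ ⟨$⟩ˡ y)           ≡⟨ cong (lookup A) (Group.⁻¹-cong (Sym (Fin n)) {θ} {π} θ≈π y) ⟩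
    lookup A (π ⟨$⟩ˡ y)           ≡⟨ lookup-image π A y ⟨
    lookup (image (π ⟨$⟩ʳ_) A) y  ∎)
    where open ≡-Reasoning

  ρ-homo : ∀ θ π → ρ n i (Group._∙_ (Sym (Fin n)) θ π) ≈ Group._∙_ (Sym V) (ρ n i θ) (ρ n i π)
  ρ-homo θ π (A , _) = JVertex-≡ (lookup-ext λ y → begin
    lookup (image (λ x → θ ⟨$⟩ʳ (π ⟨$⟩ʳ x)) A) y           ≡⟨ lookup-image (Group._∙_ (Sym (Fin n)) θ π) A y ⟩
    lookup A (π ⟨$⟩ˡ (θ ⟨$⟩ˡ y))                           ≡⟨ lookup-image π A (θ ⟨$⟩ˡ y) ⟨
    lookup (image (π ⟨$⟩ʳ_) A) (θ ⟨$⟩ˡ y)                  ≡⟨ lookup-image θ (image (π ⟨$⟩ʳ_) A) y ⟨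
    lookup (image (θ ⟨$⟩ʳ_) (image (π ⟨$⟩ʳ_) A)) y         ∎)
    where open ≡-Reasoning

  ρ-ε : ρ n i (Group.ε (Sym (Fin n))) ≈ Group.ε (Sym V)
  ρ-ε (A , _) = JVertex-≡ (lookup-ext (lookup-image (Group.ε (Sym (Fin n))) A))

  -- If the actions agree, θ⁻¹(y) and π⁻¹(y) belong to the same vertices and so coincide; inverting
  -- gives the agreement of θ and π.
  ρ-injective : 2 ≤ i → 2 + i ≤ n → ∀ {θ π : Permutation′ n} → ρ n i θ ≈ ρ n i π →
                ∀ x → θ ⟨$⟩ʳ x ≡ π ⟨$⟩ʳ x
  ρ-injective 2≤i 2+i≤n {θ} {π} e = Group.⁻¹-cong (Sym (Fin n)) {flip θ} {flip π} λ y →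
    χ-separates 2≤i 2+i≤n λ D → cong bit (begin
      lookup (proj₁ D) (θ ⟨$⟩ˡ y)           ≡⟨ lookup-image θ (proj₁ D) y ⟨
      lookup (image (θ ⟨$⟩ʳ_) (proj₁ D)) y  ≡⟨ cong (λ B → lookup (proj₁ B) y) (e D) ⟩
      lookup (image (π ⟨$⟩ʳ_) (proj₁ D)) y  ≡⟨ lookup-image π (proj₁ D) y ⟩
      lookup (proj₁ D) (π ⟨$⟩ˡ y)           ∎)
    where open ≡-Reasoning

  ρ-isGroupMonomorphism : 2 ≤ i → 2 + i ≤ n →
    GroupMorphisms.IsGroupMonomorphism (Group.rawGroup (Sym (Fin n))) (Group.rawGroup (Sym V)) (ρ n i)
  ρ-isGroupMonomorphism 2≤i 2+i≤n = record
    { isGroupHomomorphism = record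
      { isMonoidHomomorphism = record
        { isMagmaHomomorphism = record
          { isRelHomomorphism = record { cong = λ {θ} {π} → ρ-cong {θ} {π} }
          ; homo              = ρ-homo
          }
        ; ε-homo = ρ-ε
        }
      ; ⁻¹-homo = λ θ A → JVertex-≡ refl
      }
    ; injective = λ {θ} {π} → ρ-injective 2≤i 2+i≤n {θ} {π}
    }

  ρ-Image-isSubgroup : IsSubgroup (Sym V) (ρ-Image n i)
  ρ-Image-isSubgroup = record
    { resp-≈    = λ σ≈τ (θ , e) → θ , λ A → trans (sym (σ≈τ A)) (e A)
    ; ε-closed  = Group.ε (Sym (Fin n)) , λ A → sym (ρ-ε A)
    ; ∙-closed  = λ {σ} (θ , e) (π , f) → Group._∙_ (Sym (Fin n)) θ π , λ A →
        trans (cong (Inverse.to σ) (f A)) (trans (e _) (sym (ρ-homo θ π A)))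
    ; ⁻¹-closed = λ {σ} (θ , e) → flip θ , λ A →
        trans (⁻¹-cong {σ} {ρ n i θ} e A) (JVertex-≡ refl)
    }

  ρ∈Aut : ∀ θ → Aut (J n i) (ρ n i θ)
  ρ∈Aut θ (A , _) (B , _) = mk⇔ (trans (cong suc e)) (trans (cong suc (sym e)))
    where
    e : ∣ image (θ ⟨$⟩ʳ_) A ∩ image (θ ⟨$⟩ʳ_) B ∣ ≡ ∣ A ∩ B ∣
    e = trans (cong ∣_∣ (image-∩ θ A B)) (∣image∣ θ (A ∩ B))

-- Complementation as a central automorphism, and the decomposition.

T∈Aut : ∀ i → Aut (J (2 * i) i) (T i)
T∈Aut i (A , ∣A∣≡i) (B , ∣B∣≡i) = mk⇔ (trans (cong suc e)) (trans (cong suc (sym e)))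
  where
  e : ∣ ∁ A ∩ ∁ B ∣ ≡ ∣ A ∩ B ∣
  e = +-cancelʳ-≡ (2 * i) _ _ (trans
    (cong (∣ ∁ A ∩ ∁ B ∣ +_) (trans (cong (i +_) (+-identityʳ i)) (sym (cong₂ _+_ ∣A∣≡i ∣B∣≡i))))
    (trans (∣∁∩∁∣ A B) (+-comm (2 * i) _)))

-- σ keeps the intersection of A with its complement empty, so all i elements of σ(A^c) lie in the
-- complement of σ A, which itself has only i elements.
T-central : ∀ i (σ : JVertex (2 * i) i ↔ JVertex (2 * i) i) → Aut (J (2 * i) i) σ →
            ∀ A → Inverse.to σ (Inverse.to (T i) A) ≡ Inverse.to (T i) (Inverse.to σ A)
T-central i σ aut A = sym (vertex-≡ _ _ (begin
  ∣ ∁ σA ∩ σTA ∣                 ≡⟨ cong (_+ ∣ ∁ σA ∩ σTA ∣) disjoint ⟨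
  ∣ σA ∩ σTA ∣ + ∣ ∁ σA ∩ σTA ∣  ≡⟨ ∣∩∣+∣∁∩∣ σA σTA ⟩
  ∣ σTA ∣                        ≡⟨ proj₂ (Inverse.to σ (Inverse.to (T i) A)) ⟩
  i                              ∎))
  where
  open ≡-Reasoning
  σA  = proj₁ (Inverse.to σ A)
  σTA = proj₁ (Inverse.to σ (Inverse.to (T i) A))
  disjoint : ∣ σA ∩ σTA ∣ ≡ 0
  disjoint = trans (aut-isometry {σ = σ} aut A (Inverse.to (T i) A))
                   (trans (cong ∣_∣ (∩-inverseʳ (proj₁ A))) (∣⊥∣≡0 (2 * i)))

theorem1 : ∀ (i : ℕ) → 3 ≤ i →
    let n = 2 * i
        Sₙ = Sym (Fin n)
        SymV = Sym (JVertex n i)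
    in GroupMorphisms.IsGroupMonomorphism (Group.rawGroup Sₙ) (Group.rawGroup SymV) (ρ n i)
       × IsInternalDirectProduct SymV (Aut (J n i)) (ρ-Image n i) (Generated SymV (T i))
theorem1 i@(suc (suc (suc k))) 3≤i@(s≤s (s≤s (s≤s _))) =
  ρ-isGroupMonomorphism (2 * i) i 2≤i (2≤i⇒2+i≤2*i 2≤i) ,
  central⇒internalDirectProduct SymV Aut-isSubgroup (ρ-Image-isSubgroup (2 * i) i)
    (Generated-isSubgroup SymV)
    (λ {σ} → ρ-Image⊑Aut {σ})
    (generated-⊑ SymV Aut-isSubgroup (T∈Aut i))
    (λ {g} {x} → central {g} {x})
    (λ {x} → trivial {x})
    (λ {σ} → factor σ)
  where
  SymV = Sym (JVertex (2 * i) i)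
  AutJ = Aut (J (2 * i) i)
  open Group SymV using (_≈_; _∙_; ε)
  2≤i = ≤-trans (n≤1+n 2) 3≤i
  T²≈ε : T i ∙ T i ≈ ε
  T²≈ε A = JVertex-≡ (∁-involutive (proj₁ A))
  ρ-Image⊑Aut : ρ-Image (2 * i) i ⊑ AutJ
  ρ-Image⊑Aut {σ} (θ , e) = IsSubgroup.resp-≈ (Aut-isSubgroup {2 * i} {i}) {ρ (2 * i) i θ} {σ}
    (λ A → sym (e A)) (ρ∈Aut (2 * i) i θ)
  central : ∀ {g x} → AutJ g → Generated SymV (T i) x → g ∙ x ≈ x ∙ g
  central {g} {x} g∈Aut x∈⟨T⟩ =
    generated-⊑ SymV {t = T i} (centralizer-isSubgroup SymV AutJ) (λ {h} → T-central i h) {x} x∈⟨T⟩ {g} g∈Aut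
  -- Any vertex containing both 0 and θ⁻¹(0) tells ρ_θ from T.
  ρ≉T : ∀ θ → ¬ (ρ (2 * i) i θ ≈ T i)
  ρ≉T θ e =
    let p = θ ⟨$⟩ˡ zero
        D , U⊆D , _ , ∣D∣≡i = between {U = ⁅ zero ⁆ ∪ ⁅ p ⁆} {⊤} i ⊆⊤
          (≤-trans (∣pair∣≤2 zero p) 2≤i)
          (≤-trans (m≤m+n i (i + 0)) (≤-reflexive (sym (∣⊤∣≡n (2 * i)))))
        0∈∁D = lookup⇒[]= zero (∁ D) (trans (cong (λ B → lookup (proj₁ B) zero) (sym (e (D , ∣D∣≡i))))
                 (trans (lookup-image θ D zero) ([]=⇒lookup (U⊆D (x∈p∪q⁺ (inj₂ (x∈⁅x⁆ p)))))))
    in x∈∁p⇒x∉p 0∈∁D (U⊆D (x∈p∪q⁺ {p = ⁅ zero ⁆} (inj₁ (x∈⁅x⁆ zero))))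
  trivial : ∀ {x} → ρ-Image (2 * i) i x → Generated SymV (T i) x → x ≈ ε
  trivial {x} (θ , e) x∈⟨T⟩ = [ (λ x≈ε → x≈ε) , (λ x≈T → contradiction (λ A → trans (sym (e A)) (x≈T A)) (ρ≉T θ)) ]′
    (generated-⊑ SymV {t = T i} (involution-isSubgroup SymV {T i} T²≈ε) (inj₂ λ _ → refl) {x} x∈⟨T⟩)
  factor : ∀ σ → AutJ σ → ∃₂ λ h x → ρ-Image (2 * i) i h × Generated SymV (T i) x × σ ≈ h ∙ x
  factor σ σ∈Aut =
    [ (λ (θ , e) → ρ (2 * i) i θ , ε , (θ , λ _ → refl) , unit , e)
    -- Here σ ∘ T = ρ_θ, and T² = ε turns this into σ = ρ_θ ∘ T.
    , (λ (θ , e) → ρ (2 * i) i θ , T i , (θ , λ _ → refl) , gen , λ A →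
        trans (cong (Inverse.to σ) (sym (T²≈ε A))) (e (Inverse.to (T i) A)))
    ]′ (aut⇒ρ⊎ρT k σ σ∈Aut)
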